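{- The set $\{[A]\in\mathrm{MALG}: \text{there is no } D\in\boldsymbol{\Delta}^0_2 \text{ with } \mu(A\,\triangle\, D)=0\}$ is comeager in $\mathrm{MALG}$.
   Context: $2^\omega$ is the Cantor space; $\mu$ is the coin-tossing measure ($\mu(N_s)=2^{ -\mathrm{lh}(s)}$, $N_s=\{x:s\subset x\}$). $\mathrm{MALG}$ is the measure algebra: the set of equivalence classes $[A]$ of $\mu$-measurable subsets of $2^\omega$ under $A\equiv B\iff\mu(A\triangle B)=0$, endowed with the complete separable metric $\delta([A],[B])=\mu(A\triangle B)$, which makes it a Polish space. $\boldsymbol{\Delta}^0_2$ is the class of sets that are simultaneously $F_\sigma$ and $G_\delta$. -}

module Defs where

open import Axiom.ExcludedMiddle using (ExcludedMiddle)
open import Data.Bool.Base using (Bool; true)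
open import Data.Empty using (⊥-elim)
open import Data.Fin.Base using (Fin; toℕ)
open import Data.Integer.Base as ℤ using (+_; -[1+_]; +[1+_])
open import Data.List.Base using (List; []; _∷_; length; lookup; foldr; applyUpTo; replicate)
open import Data.Nat.Base as ℕ using (ℕ; zero; suc)
import Data.Nat.Properties as ℕ
open import Data.Product.Base using (Σ-syntax; ∃-syntax; _×_; _,_)
open import Data.Rational.Base
  using (ℚ; mkℚ; 0ℚ; 1ℚ; ½; _+_; _*_; _≤_; _<_; *<*; toℚᵘ)
open import Data.Rational.Properties
open import Data.Rational.Unnormalised.Base using (mkℚᵘ) renaming (_≃_ to _≃ᵘ_; *<* to *<*ᵘ)
import Data.Rational.Unnormalised.Properties as ℚᵘ
open import Data.Sum.Base using (inj₁; inj₂)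
open import Function.Base using (_∘_)
open import Level using (Level; 0ℓ; Lift; lift; lower) renaming (suc to lsuc)
open import Relation.Binary.Core using (Rel)
open import Relation.Binary.Definitions using (_Respects_)
open import Relation.Binary.PropositionalEquality
  using (_≡_; _≗_; sym; subst; module ≡-Reasoning)
open import Relation.Nullary.Decidable.Core using (Dec; yes; no; map′; toWitness)
open import Relation.Unary using (Pred; _∈_; _⊆_; _≐_; _∪_; _∖_; ∁; ⋃; ⋂; Empty)

-- A nonnegative real number r is represented by the set { q ∈ ℚ ∣ r < q }.
-- Strict inequalities against rationals are all that is needed of measures
-- and distances.

UpperCut : Set₁
UpperCut = Pred ℚ 0ℓ

IsZero : UpperCut → Set
IsZero r = ∀ {q} → 0ℚ < q → q ∈ r

-- The points of the metric space are the classes of _≈_: x and y are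
-- identified when their distance is 0.

record MetricSpace (a : Level) : Set (lsuc a) where
  field
    Carrier  : Set a
    d        : Carrier → Carrier → UpperCut
    positive : ∀ {x y q} → q ∈ d x y → 0ℚ < q
    upward   : ∀ {x y p q} → p < q → p ∈ d x y → q ∈ d x y
    rounded  : ∀ {x y q} → q ∈ d x y → ∃[ p ] p < q × p ∈ d x y
    finite   : ∀ {x y} → ∃[ q ] q ∈ d x y
    d-refl   : ∀ {x} → IsZero (d x x)
    d-sym    : ∀ {x y q} → q ∈ d x y → q ∈ d y x
    triangle : ∀ {x y z p q} → p ∈ d x y → q ∈ d y z → p + q ∈ d x z

  infix 4 _≈_

  _≈_ : Rel Carrier 0ℓ
  x ≈ y = IsZero (d x y)

  interior : Pred Carrier a → Pred Carrier a
  interior P x = ∃[ ε ] 0ℚ < ε × (∀ {y} → ε ∈ d x y → y ∈ P)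

  closure : Pred Carrier a → Pred Carrier a
  closure P x = ∀ {ε} → 0ℚ < ε → ∃[ y ] ε ∈ d x y × y ∈ P

  NowhereDense : Pred Carrier a → Set a
  NowhereDense P = Empty (interior (closure P))

  -- Subsets of the quotient by _≈_ are the predicates respecting _≈_.

  Meager : Pred Carrier a → Set (lsuc a)
  Meager P = Σ[ N ∈ (ℕ → Pred Carrier a) ]
    (∀ n → N n Respects _≈_ × NowhereDense (N n)) × P ≐ ⋃ ℕ N

  Comeager : Pred Carrier a → Set (lsuc a)
  Comeager P = Meager (∁ P)

-- Points are compared by _≗_, since function extensionality is not
-- available; subsets are the predicates respecting _≗_.

Cantor : Set
Cantor = ℕ → Bool

⟦_⟧ : List Bool → Pred Cantor 0ℓ
⟦ s ⟧ x = ∀ (i : Fin (length s)) → x (toℕ i) ≡ lookup s i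

-- Open sets, and hence closed sets, Gδ sets and (classically) Fσ sets,
-- respect _≗_ automatically.

Open : Pred Cantor 0ℓ → Set
Open U = ∀ {x} → x ∈ U → ∃[ s ] x ∈ ⟦ s ⟧ × ⟦ s ⟧ ⊆ U

Closed : Pred Cantor 0ℓ → Set
Closed F = Open (∁ F)

Fσ : Pred Cantor 0ℓ → Set₁
Fσ A = Σ[ F ∈ (ℕ → Pred Cantor 0ℓ) ] (∀ n → Closed (F n)) × A ≐ ⋃ ℕ F

Gδ : Pred Cantor 0ℓ → Set₁
Gδ A = Σ[ U ∈ (ℕ → Pred Cantor 0ℓ) ] (∀ n → Open (U n)) × A ≐ ⋂ ℕ U

Δ⁰₂ : Pred Cantor 0ℓ → Set₁
Δ⁰₂ A = Fσ A × Gδ A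

weight : List Bool → ℚ
weight []      = 1ℚ
weight (_ ∷ s) = ½ * weight s

∑weights : (ℕ → List Bool) → ℕ → ℚ
∑weights c n = foldr _+_ 0ℚ (applyUpTo (weight ∘ c) n)

-- q ∈ μ A means that A is covered by cylinders of total weight less than q.
-- So μ is defined on all sets, as the outer measure; the coin-tossing
-- measure is its restriction to the measurable sets.

μ : Pred Cantor 0ℓ → UpperCut
μ A q = Σ[ c ∈ (ℕ → List Bool) ]
  A ⊆ ⋃ ℕ (⟦_⟧ ∘ c) × (∃[ r ] r < q × (∀ n → ∑weights c n ≤ r))

Null : Pred Cantor 0ℓ → Set
Null A = IsZero (μ A)

-- The σ-algebra generated by the open sets and the null sets.

data Measurable : Pred Cantor 0ℓ → Set₁ where
  open-set   : ∀ {A} → Open A → Measurable A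
  null-set   : ∀ {A} → A Respects _≗_ → Null A → Measurable A
  complement : ∀ {A} → Measurable A → Measurable (∁ A)
  union      : ∀ {A : ℕ → Pred Cantor 0ℓ} →
               (∀ n → Measurable (A n)) → Measurable (⋃ ℕ A)
  same       : ∀ {A B} → A ≐ B → Measurable A → Measurable B

infixr 6 _△_

_△_ : Pred Cantor 0ℓ → Pred Cantor 0ℓ → Pred Cantor 0ℓ
A △ B = (A ∖ B) ∪ (B ∖ A)

record MeasurableSet : Set₁ where
  field
    set        : Pred Cantor 0ℓ
    measurable : Measurable set

open MeasurableSet public

μ-mono : ∀ {A B q} → A ⊆ B → q ∈ μ B → q ∈ μ A
μ-mono A⊆B (c , cov , bound) = c , (λ x∈A → cov (A⊆B x∈A)) , bound

μ-positive : ∀ {A q} → q ∈ μ A → 0ℚ < q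
μ-positive (c , _ , r , r<q , ∑≤r) = ≤-<-trans (∑≤r 0) r<q

μ-upward : ∀ {A p q} → p < q → p ∈ μ A → q ∈ μ A
μ-upward p<q (c , cov , r , r<p , ∑≤r) = c , cov , r , <-trans r<p p<q , ∑≤r

μ-rounded : ∀ {A q} → q ∈ μ A → ∃[ p ] p < q × p ∈ μ A
μ-rounded (c , cov , r , r<q , ∑≤r) with <-dense r<q
... | p , r<p , p<q = p , p<q , c , cov , r , r<p , ∑≤r

interleave : {X : Set} → (ℕ → X) → (ℕ → X) → ℕ → X
interleave f g zero    = f zero
interleave f g (suc n) = interleave g (f ∘ suc) n

weight-nonNeg : ∀ s → 0ℚ ≤ weight s
weight-nonNeg []      = nonNegative⁻¹ 1ℚ
weight-nonNeg (_ ∷ s) =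
  subst (_≤ ½ * weight s) (*-zeroʳ ½) (*-monoˡ-≤-nonNeg ½ (weight-nonNeg s))

∑weights-step : ∀ c n → ∑weights c n ≤ ∑weights c (suc n)
∑weights-step c zero    =
  subst (0ℚ ≤_) (sym (+-identityʳ (weight (c 0)))) (weight-nonNeg (c 0))
∑weights-step c (suc n) = +-monoʳ-≤ (weight (c 0)) (∑weights-step (c ∘ suc) n)

∑weights-interleave : ∀ c e n →
  ∑weights (interleave c e) n ≤ ∑weights c n + ∑weights e n
∑weights-interleave c e zero    = ≤-reflexive (sym (+-identityʳ 0ℚ))
∑weights-interleave c e (suc n) = begin
  weight (c 0) + ∑weights (interleave e (c ∘ suc)) n
    ≤⟨ +-monoʳ-≤ (weight (c 0)) (∑weights-interleave e (c ∘ suc) n) ⟩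
  weight (c 0) + (∑weights e n + ∑weights (c ∘ suc) n)
    ≡⟨ rearrange (weight (c 0)) (∑weights e n) (∑weights (c ∘ suc) n) ⟩
  ∑weights c (suc n) + ∑weights e n
    ≤⟨ +-monoʳ-≤ (∑weights c (suc n)) (∑weights-step e n) ⟩
  ∑weights c (suc n) + ∑weights e (suc n) ∎
  where
  open ≤-Reasoning
  rearrange : ∀ x y z → x + (y + z) ≡ (x + z) + y
  rearrange x y z rewrite +-comm y z = sym (+-assoc x z y)

mutual
  in-left : ∀ {X : Set} (P : Pred X 0ℓ) (f g : ℕ → X) i →
            P (f i) → ∃[ j ] P (interleave f g j)
  in-left P f g zero    p = zero , p
  in-left P f g (suc i) p with in-right P g (f ∘ suc) i p
  ... | j , q = suc j , q

  in-right : ∀ {X : Set} (P : Pred X 0ℓ) (f g : ℕ → X) i →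
             P (g i) → ∃[ j ] P (interleave f g j)
  in-right P f g i p with in-left P g (f ∘ suc) i p
  ... | j , q = suc j , q

-- cylinders of weights 2⁻ᵏ, 2⁻ᵏ⁻¹, 2⁻ᵏ⁻², …
shrinking : ℕ → ℕ → List Bool
shrinking k zero    = replicate k true
shrinking k (suc i) = shrinking (suc k) i

½^_ : ℕ → ℚ
½^ k = weight (replicate k true)

½^-double : ∀ k → ½^ suc k + ½^ suc k ≡ ½^ k
½^-double k = begin
  ½ * ½^ k + ½ * ½^ k ≡⟨ *-distribʳ-+ (½^ k) ½ ½ ⟨
  1ℚ * ½^ k           ≡⟨ *-identityˡ (½^ k) ⟩
  ½^ k                ∎
  where open ≡-Reasoning

∑shrinking : ∀ k n → ∑weights (shrinking k) n ≤ ½^ k + ½^ k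
∑shrinking k zero    =
  +-mono-≤ (weight-nonNeg (replicate k true)) (weight-nonNeg (replicate k true))
∑shrinking k (suc n) =
  +-monoʳ-≤ (½^ k) (≤-trans (∑shrinking (suc k) n) (≤-reflexive (½^-double k)))

pred2^_ : ℕ → ℕ
pred2^ zero  = 0
pred2^ suc k = pred2^ k ℕ.+ suc (pred2^ k ℕ.+ 0)

k≤pred2^k : ∀ k → k ℕ.≤ pred2^ k
k≤pred2^k zero    = ℕ.z≤n
k≤pred2^k (suc k) =
  ℕ.≤-trans (ℕ.s≤s (ℕ.≤-trans (k≤pred2^k k) (ℕ.m≤m+n _ _))) (ℕ.m≤n+m _ _)

½^-toℚᵘ : ∀ k → toℚᵘ (½^ k) ≃ᵘ mkℚᵘ (+ 1) (pred2^ k)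
½^-toℚᵘ zero    = ℚᵘ.≃-refl
½^-toℚᵘ (suc k) = ℚᵘ.≃-trans (toℚᵘ-homo-* ½ (½^ k)) (ℚᵘ.*-congˡ {toℚᵘ ½} (½^-toℚᵘ k))

½^-small : ∀ {q} → 0ℚ < q → ∃[ k ] ½^ k < q
½^-small {mkℚ (+ zero)  d _} (*<* (ℤ.+<+ ()))
½^-small {mkℚ -[1+ n ]  d _} (*<* ())
½^-small {mkℚ +[1+ n ]  d c} _ = suc d , toℚᵘ-cancel-<
  (ℚᵘ.<-respˡ-≃ (ℚᵘ.≃-sym {x = toℚᵘ (½^ suc d)} (½^-toℚᵘ (suc d))) (*<*ᵘ (ℤ.+<+ (begin-strict
    1 ℕ.* suc d                   ≡⟨ ℕ.*-identityˡ (suc d) ⟩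
    suc d                         <⟨ ℕ.s≤s (k≤pred2^k (suc d)) ⟩
    suc (pred2^ suc d)            ≤⟨ ℕ.m≤n*m _ (suc n) ⟩
    suc n ℕ.* suc (pred2^ suc d)  ∎))))
  where open ℕ.≤-Reasoning

μ-empty : ∀ {A} → Empty A → Null A
μ-empty empty 0<q with ½^-small 0<q
... | k , ½^k<q = shrinking (suc k) , (λ {x} x∈A → ⊥-elim (empty x x∈A)) ,
  ½^ k , ½^k<q ,
  λ n → ≤-trans (∑shrinking (suc k) n) (≤-reflexive (½^-double k))

μ-finite : ∀ {A} → ∃[ q ] q ∈ μ A
μ-finite = 1ℚ + 1ℚ + 1ℚ , shrinking 0 , (λ _ → 0 , λ ()) ,
  1ℚ + 1ℚ , toWitness {a? = 1ℚ + 1ℚ <? 1ℚ + 1ℚ + 1ℚ} _ , ∑shrinking 0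

μ-subadditive : ∀ {A B p q} → p ∈ μ A → q ∈ μ B → p + q ∈ μ (A ∪ B)

μ-subadditive (c , covA , r , r<p , ∑≤r) (e , covB , s , s<q , ∑≤s) =
  interleave c e ,
  (λ { {x} (inj₁ x∈A) → let i , x∈c = covA x∈A in in-left  (λ t → x ∈ ⟦ t ⟧) c e i x∈c
     ; {x} (inj₂ x∈B) → let i , x∈e = covB x∈B in in-right (λ t → x ∈ ⟦ t ⟧) c e i x∈e }) ,
  r + s , +-mono-< r<p s<q ,
  λ n → ≤-trans (∑weights-interleave c e n) (+-mono-≤ (∑≤r n) (∑≤s n))

△-sym : ∀ {A B} → A △ B ⊆ B △ A
△-sym (inj₁ p) = inj₂ p
△-sym (inj₂ p) = inj₁ p

△-irrefl : ∀ {A} → Empty (A △ A)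
△-irrefl x (inj₁ (p , ¬p)) = ¬p p
△-irrefl x (inj₂ (p , ¬p)) = ¬p p

△-triangle : ExcludedMiddle (lsuc 0ℓ) → ∀ {A B C} → A △ C ⊆ (A △ B) ∪ (B △ C)
△-triangle em {A} {B} {C} {x} = go (map′ lower lift (em {Lift (lsuc 0ℓ) (B x)}))
  where
  go : Dec (B x) → x ∈ A △ C → x ∈ (A △ B) ∪ (B △ C)
  go (yes b) (inj₁ (a , ¬c)) = inj₂ (inj₁ (b , ¬c))
  go (no ¬b) (inj₁ (a , ¬c)) = inj₁ (inj₁ (a , ¬b))
  go (yes b) (inj₂ (c , ¬a)) = inj₁ (inj₂ (b , ¬a))
  go (no ¬b) (inj₂ (c , ¬a)) = inj₂ (inj₂ (c , ¬b))

-- The class [A] is represented by A itself, and _≈_ of this metric space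
-- says that the symmetric difference is null.  The triangle inequality for
-- symmetric differences, and hence transitivity of _≈_, needs excluded
-- middle.

MALG : ExcludedMiddle (lsuc 0ℓ) → MetricSpace (lsuc 0ℓ)
MALG em = record
  { Carrier  = MeasurableSet
  ; d        = λ A B → μ (set A △ set B)
  ; positive = μ-positive
  ; upward   = μ-upward
  ; rounded  = μ-rounded
  ; finite   = μ-finite
  ; d-refl   = λ {A} → μ-empty (△-irrefl {set A})
  ; d-sym    = λ {A} {B} → μ-mono (△-sym {set B} {set A})
  ; triangle = λ {A} {B} {C} p q →
      μ-mono (△-triangle em {set A} {set B} {set C}) (μ-subadditive p q)
  }

{-# OPTIONS --safe #-}

-- By the Baire category theorem, some cylinder is contained in a Δ⁰₂ set D or
-- in its complement, so every A that is Δ⁰₂ up to a null set is almost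
-- everywhere constant on some cylinder s.  For fixed s and fixed constant, the
-- classes with this property are nowhere dense: changing A on a small
-- subcylinder t of s moves it by at most μ ⟦ t ⟧, and the result keeps a positive
-- distance from all such classes because ⟦ t ⟧ has positive outer measure.

module Submission where

open import Defs
open import Data.Rational.Properties
open import Algebra.Bundles using (module CommutativeMonoid)
open import Algebra.Properties.CommutativeSemigroup
  (CommutativeMonoid.commutativeSemigroup +-0-commutativeMonoid) using (interchange)
open import Axiom.ExcludedMiddle using (ExcludedMiddle)
open import Data.Bool.Base using (Bool; true; false; if_then_else_)
import Data.Bool.Properties as Bool
open import Data.Empty using (⊥)
open import Data.Fin.Base using (zero; suc; toℕ; fromℕ<)
open import Data.Fin.Properties using (toℕ<n; toℕ-fromℕ<)
open import Data.List.Base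
  using (List; []; _∷_; _++_; _∷ʳ_; foldr; applyUpTo; length; replicate)
open import Data.List.Properties
  using (length-++; length-applyUpTo; lookup-applyUpTo)
open import Data.Nat.Base as ℕ using (ℕ; zero; suc; z≤n; s≤s)
open import Data.Nat.Binary.Base as ℕᵇ using (ℕᵇ; 2[1+_]; 1+[2_])
open import Data.Nat.Binary.Properties using (fromℕ-toℕ)
import Data.Nat.Properties as ℕ
open import Data.Product.Base
  using (Σ-syntax; ∃-syntax; _×_; _,_; proj₁; proj₂; uncurry)
open import Data.Rational.Base using (ℚ; 0ℚ; 1ℚ; ½; _+_; _*_; _≤_; _<_; positive)
open import Data.Sum.Base using (inj₁; inj₂; [_,_]′; map₁; map₂)
open import Data.Unit.Base using (⊤; tt)
open import Function.Base using (_∘_; id)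
open import Level using (0ℓ; Lift; lift; lower) renaming (suc to lsuc)
open import Relation.Binary.Definitions using (_Respects_)
open import Relation.Binary.PropositionalEquality
open import Relation.Nullary.Decidable.Core
  using (yes; no; does; map′; toWitness; decidable-stable)
open import Relation.Nullary.Negation.Core using (¬_; contradiction)
open import Relation.Unary
  using (Pred; _∈_; _∉_; _⊆_; _∪_; _∩_; _∖_; ∁; Empty)

-- Rational arithmetic and finite sums.

halves : ∀ q → ½ * q + ½ * q ≡ q
halves q = trans (sym (*-distribʳ-+ q ½ ½)) (*-identityˡ q)

½*-pos : ∀ {q} → 0ℚ < q → 0ℚ < ½ * q
½*-pos {q} 0<q = subst (_< ½ * q) (*-zeroʳ ½) (*-monoʳ-<-pos ½ 0<q)

½*-≤ : ∀ {q} → 0ℚ ≤ q → ½ * q ≤ q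
½*-≤ {q} 0≤q = begin
  ½ * q           ≡⟨ +-identityʳ (½ * q) ⟨
  ½ * q + 0ℚ      ≤⟨ +-monoʳ-≤ (½ * q)
                       (subst (_≤ ½ * q) (*-zeroʳ ½) (*-monoˡ-≤-nonNeg ½ 0≤q)) ⟩
  ½ * q + ½ * q   ≡⟨ halves q ⟩
  q               ∎
  where open ≤-Reasoning

-- `∑weights c` unfolds to `∑ (weight ∘ c)`, so the lemmas below apply to it directly.
∑ : (ℕ → ℚ) → ℕ → ℚ
∑ f n = foldr _+_ 0ℚ (applyUpTo f n)

∑-nonNeg : ∀ {f} → (∀ i → 0ℚ ≤ f i) → ∀ n → 0ℚ ≤ ∑ f n
∑-nonNeg 0≤f zero    = ≤-refl
∑-nonNeg 0≤f (suc n) = +-mono-≤ (0≤f 0) (∑-nonNeg (0≤f ∘ suc) n)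

∑-monoʳ-≤ : ∀ {f m n} → (∀ i → 0ℚ ≤ f i) → m ℕ.≤ n → ∑ f m ≤ ∑ f n
∑-monoʳ-≤ {n = n} 0≤f z≤n   = ∑-nonNeg 0≤f n
∑-monoʳ-≤ {f = f} 0≤f (s≤s m≤n) = +-monoʳ-≤ (f 0) (∑-monoʳ-≤ (0≤f ∘ suc) m≤n)

∑-monoˡ-≤ : ∀ {f g} → (∀ i → f i ≤ g i) → ∀ n → ∑ f n ≤ ∑ g n
∑-monoˡ-≤ f≤g zero    = ≤-refl
∑-monoˡ-≤ f≤g (suc n) = +-mono-≤ (f≤g 0) (∑-monoˡ-≤ (f≤g ∘ suc) n)

∑-cong : ∀ {f g} → f ≗ g → ∑ f ≗ ∑ g
∑-cong f≗g zero    = refl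
∑-cong f≗g (suc n) = cong₂ _+_ (f≗g 0) (∑-cong (f≗g ∘ suc) n)

∑-distrib-+ : ∀ f g n → ∑ (λ i → f i + g i) n ≡ ∑ f n + ∑ g n
∑-distrib-+ f g zero    = sym (+-identityʳ 0ℚ)
∑-distrib-+ f g (suc n) = trans
  (cong (f 0 + g 0 +_) (∑-distrib-+ (f ∘ suc) (g ∘ suc) n))
  (interchange (f 0) (g 0) _ _)

*-distribˡ-∑ : ∀ q f n → q * ∑ f n ≡ ∑ (λ i → q * f i) n
*-distribˡ-∑ q f zero    = *-zeroʳ q
*-distribˡ-∑ q f (suc n) = trans (*-distribˡ-+ q (f 0) _)
  (cong (q * f 0 +_) (*-distribˡ-∑ q (f ∘ suc) n))

term≤∑ : ∀ {f} → (∀ i → 0ℚ ≤ f i) → ∀ i → f i ≤ ∑ f (suc i)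
term≤∑ {f} 0≤f zero    = ≤-reflexive (sym (+-identityʳ (f 0)))
term≤∑ {f} 0≤f (suc i) = ≤-trans (term≤∑ (0≤f ∘ suc) i)
  (≤-trans (≤-reflexive (sym (+-identityˡ _))) (+-monoˡ-≤ _ (0≤f 0)))

-- Cylinders and prefixes.

weight-pos : ∀ s → 0ℚ < weight s
weight-pos []      = toWitness {a? = 0ℚ <? 1ℚ} _
weight-pos (_ ∷ s) = ½*-pos (weight-pos s)

weight-++-≤ : ∀ s t → weight (s ++ t) ≤ weight t
weight-++-≤ []      t = ≤-refl
weight-++-≤ (_ ∷ s) t = ≤-trans (½*-≤ (weight-nonNeg (s ++ t))) (weight-++-≤ s t)

cylinder-++ : ∀ s t → ⟦ s ++ t ⟧ ⊆ ⟦ s ⟧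
cylinder-++ (_ ∷ s) t {x} h zero    = h zero
cylinder-++ (_ ∷ s) t {x} h (suc i) = cylinder-++ s t {x ∘ suc} (h ∘ suc) i

length-∷ʳ : ∀ (s : List Bool) b → length s ℕ.< length (s ∷ʳ b)
length-∷ʳ s b = subst (length s ℕ.<_)
  (sym (trans (length-++ s) (ℕ.+-comm (length s) 1))) ℕ.≤-refl

-- The padding value `false` is arbitrary: the limit below only reads coordinates inside the string.
at : List Bool → Cantor
at []      _       = false
at (b ∷ _) zero    = b
at (_ ∷ s) (suc i) = at s i

at-∈ : ∀ s → at s ∈ ⟦ s ⟧
at-∈ (b ∷ s) zero    = refl
at-∈ (b ∷ s) (suc i) = at-∈ s i

cylinder-agree : ∀ s {x y i} → x ∈ ⟦ s ⟧ → y ∈ ⟦ s ⟧ → i ℕ.< length s → x i ≡ y i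
cylinder-agree s {x} {y} x∈s y∈s i<s =
  subst (λ j → x j ≡ y j) (toℕ-fromℕ< i<s)
    (trans (x∈s (fromℕ< i<s)) (sym (y∈s (fromℕ< i<s))))

prefix-∈ : ∀ x k → x ∈ ⟦ applyUpTo x k ⟧
prefix-∈ x k i = sym (lookup-applyUpTo x k i)

prefix-⊆ : ∀ s {x k} → x ∈ ⟦ s ⟧ → length s ℕ.≤ k → ⟦ applyUpTo x k ⟧ ⊆ ⟦ s ⟧
prefix-⊆ s {x} {k} x∈s s≤k {y} y∈ i = trans
  (cylinder-agree (applyUpTo x k) {y} {x} y∈ (prefix-∈ x k)
    (subst (toℕ i ℕ.<_) (sym (length-applyUpTo x k)) (ℕ.≤-trans (toℕ<n i) s≤k)))
  (x∈s i)

-- A prefix of `x` longer than both `s` and a basic neighbourhood of `x` inside `V` works. The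
-- strict growth in length is what `branch` requires.
open-refine : ∀ {V} → Open V → ∀ s {x} → x ∈ ⟦ s ⟧ → x ∈ V →
              ∃[ t ] length s ℕ.< length t × ⟦ t ⟧ ⊆ ⟦ s ⟧ × ⟦ t ⟧ ⊆ V
open-refine V-open s {x} x∈s x∈V with V-open {x} x∈V
... | u , x∈u , u⊆V =
  applyUpTo x k ,
  subst (length s ℕ.<_) (sym (length-applyUpTo x k)) (s≤s (ℕ.m≤m⊔n _ _)) ,
  (λ {y} → prefix-⊆ s {x} x∈s (ℕ.m≤n⇒m≤1+n (ℕ.m≤m⊔n _ _)) {y}) ,
  (λ {y} y∈ → u⊆V {y} (prefix-⊆ u {x} x∈u (ℕ.m≤n⇒m≤1+n (ℕ.m≤n⊔m (length s) _)) {y} y∈))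
  where k = suc (length s ℕ.⊔ length u)

-- Limits of nested cylinders.

module _ (R : ℕ → Pred (List Bool) 0ℓ)
  (extend : ∀ n s → R n s →
            ∃[ t ] length s ℕ.< length t × ⟦ t ⟧ ⊆ ⟦ s ⟧ × R (suc n) t)
  {s : List Bool} (Rs : R 0 s)
  where

  private
    chain : ∀ n → ∃[ t ] R n t
    chain zero    = s , Rs
    chain (suc n) with extend n (proj₁ (chain n)) (proj₂ (chain n))
    ... | t , _ , _ , Rt = t , Rt

    stage : ℕ → List Bool
    stage n = proj₁ (chain n)

    stage-length : ∀ n → n ℕ.≤ length (stage n)
    stage-length zero    = z≤n
    stage-length (suc n) with extend n (proj₁ (chain n)) (proj₂ (chain n))
                            | stage-length n
    ... | _ , s<t , _ | ih = ℕ.≤-trans (s≤s ih) s<t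

    stage-step : ∀ n → ⟦ stage (suc n) ⟧ ⊆ ⟦ stage n ⟧
    stage-step n {x} with extend n (proj₁ (chain n)) (proj₂ (chain n))
    ... | _ , _ , t⊆s , _ = t⊆s {x}

    stage-antitone : ∀ {m n} → m ℕ.≤′ n → ⟦ stage n ⟧ ⊆ ⟦ stage m ⟧
    stage-antitone ℕ.≤′-refl            h = h
    stage-antitone (ℕ.≤′-step m≤n) {x} h =
      stage-antitone m≤n {x} (stage-step _ {x} h)

    limit : Cantor
    -- Stage `i` may have length exactly `i`; coordinate `i` is certain to be decided only at stage
    -- `suc i`.
    limit i = at (stage (suc i)) i

    limit-∈ : ∀ n → limit ∈ ⟦ stage n ⟧
    limit-∈ n i = trans
      -- The point `at (stage m)` lies in both `⟦ stage n ⟧` and `⟦ stage (suc j) ⟧`, so it links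
      -- the two.
      (cylinder-agree (stage (suc j)) {at (stage (suc j))} {at (stage m)}
        (at-∈ (stage (suc j)))
        (stage-antitone (ℕ.≤⇒≤′ (ℕ.m≤n⊔m n (suc j))) {at (stage m)} (at-∈ (stage m)))
        (stage-length (suc j)))
      (stage-antitone (ℕ.≤⇒≤′ (ℕ.m≤m⊔n n (suc j))) {at (stage m)} (at-∈ (stage m)) i)
      where
      j = toℕ i
      m = n ℕ.⊔ suc j

  -- Strictly longer strings with nested cylinders shrink to a point. This compactness argument
  -- serves both the lower bound for outer measure and the Baire category argument; the index of `R`
  -- lets stage `n` carry its own requirement.
  branch : ∃[ x ] ∀ n → ∃[ t ] x ∈ ⟦ t ⟧ × n ℕ.≤ length t × R n t
  branch = limit , λ n → stage n , limit-∈ n , stage-length n , proj₂ (chain n)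

-- Conditional measures of cylinders.

-- The conditional measure of ⟦ c ⟧ given ⟦ u ⟧.

share : List Bool → List Bool → ℚ
share []        _       = 1ℚ
share c@(_ ∷ _) []      = weight c
share (a ∷ c)   (b ∷ u) = if does (a Bool.≟ b) then share c u else 0ℚ

share-[] : ∀ c → share c [] ≡ weight c
share-[] []      = refl
share-[] (_ ∷ _) = refl

share-nonNeg : ∀ c u → 0ℚ ≤ share c u
share-nonNeg []        _       = nonNegative⁻¹ 1ℚ
share-nonNeg c@(_ ∷ _) []      = weight-nonNeg c
share-nonNeg (a ∷ c)   (b ∷ u) with a Bool.≟ b
... | yes _ = share-nonNeg c u
... | no  _ = ≤-refl

-- The martingale property: both halves of `⟦ u ⟧` have equal weight, so the conditional measure in
-- `⟦ u ⟧` is the average of those in the halves.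
share-split : ∀ c u → share c (u ∷ʳ false) + share c (u ∷ʳ true) ≡ share c u + share c u
share-split []          _       = refl
share-split (false ∷ c) []      = trans (+-identityʳ _)
  (trans (share-[] c) (sym (halves (weight c))))
share-split (true ∷ c)  []      = trans (+-identityˡ _)
  (trans (share-[] c) (sym (halves (weight c))))
share-split (a ∷ c)     (b ∷ u) with a Bool.≟ b
... | yes _ = share-split c u
... | no  _ = refl

-- The product is the measure of `⟦ c ⟧ ∩ ⟦ u ⟧`.
weight*share≤weight : ∀ c u → weight u * share c u ≤ weight c
weight*share≤weight []        []      = ≤-reflexive (*-identityʳ 1ℚ)
weight*share≤weight []        (_ ∷ u) = ≤-trans
  (≤-reflexive (*-assoc ½ (weight u) 1ℚ))
  (≤-trans (*-monoˡ-≤-nonNeg ½ (weight*share≤weight [] u))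
           (½*-≤ (nonNegative⁻¹ 1ℚ)))
weight*share≤weight c@(_ ∷ _) []      = ≤-reflexive (*-identityˡ (weight c))
weight*share≤weight (a ∷ c)   (b ∷ u) with a Bool.≟ b
... | yes _ = ≤-trans (≤-reflexive (*-assoc ½ (weight u) (share c u)))
                (*-monoˡ-≤-nonNeg ½ (weight*share≤weight c u))
... | no  _ = ≤-trans (≤-reflexive (*-zeroʳ (weight (b ∷ u))))
                (weight-nonNeg (a ∷ c))

-- A common point makes the two strings comparable, so the longer `u` extends `c` and
-- `⟦ u ⟧ ⊆ ⟦ c ⟧`.
share-full : ∀ c u {x} → x ∈ ⟦ c ⟧ → x ∈ ⟦ u ⟧ → length c ℕ.≤ length u → share c u ≡ 1ℚ
share-full []      u       x∈c x∈u c≤u = refl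
share-full (a ∷ c) (b ∷ u) {x} x∈c x∈u (s≤s c≤u) with a Bool.≟ b
... | yes _  = share-full c u {x ∘ suc} (x∈c ∘ suc) (x∈u ∘ suc) c≤u
... | no a≢b = contradiction (trans (sym (x∈c zero)) (x∈u zero)) a≢b

-- Small cylinders, null sets and measurability.

-- A cover is an infinite sequence of cylinders, each of positive weight. Half of the budget `½^ k`
-- goes to `u` and the other half to a shrinking tail.
μ-cylinder-≤ : ∀ {u k q} → weight u ≤ ½^ suc k → ½^ k < q → q ∈ μ ⟦ u ⟧
μ-cylinder-≤ {u} {k} {q} u≤ k<q = cover , (λ x∈u → 0 , x∈u) , ½^ k , k<q , bound
  where
  cover : ℕ → List Bool
  cover zero    = u
  cover (suc i) = shrinking (suc (suc k)) i

  open ≤-Reasoning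

  bound : ∀ n → ∑weights cover n ≤ ½^ k
  bound zero    = weight-nonNeg (replicate k true)
  bound (suc n) = begin
    weight u + ∑weights (shrinking (suc (suc k))) n
      ≤⟨ +-mono-≤ u≤ (∑shrinking (suc (suc k)) n) ⟩
    ½^ suc k + (½^ suc (suc k) + ½^ suc (suc k))
      ≡⟨ cong (½^ suc k +_) (½^-double (suc k)) ⟩
    ½^ suc k + ½^ suc k
      ≡⟨ ½^-double k ⟩
    ½^ k ∎

Null-∪ : ∀ {A B} → Null A → Null B → Null (A ∪ B)
Null-∪ {A} {B} null-A null-B {q} 0<q = subst (_∈ μ (A ∪ B)) (halves q)
  (μ-subadditive {A} {B} (null-A (½*-pos 0<q)) (null-B (½*-pos 0<q)))

Null-⊆ : ∀ {A B} → A ⊆ B → Null B → Null A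
Null-⊆ {A} {B} A⊆B null-B 0<q = μ-mono {A} {B} A⊆B (null-B 0<q)

cylinder-measurable : ∀ s → Measurable ⟦ s ⟧
cylinder-measurable s = open-set λ x∈s → s , x∈s , id

Measurable-∪ : ∀ {A B} → Measurable A → Measurable B → Measurable (A ∪ B)
Measurable-∪ {A} {B} mA mB = same
  ((λ { (zero , a) → inj₁ a ; (suc _ , b) → inj₂ b }) ,
   (λ { (inj₁ a) → 0 , a ; (inj₂ b) → 1 , b }))
  (union {family} λ { zero → mA ; (suc _) → mB })
  where
  family : ℕ → Pred Cantor 0ℓ
  family zero    = A
  family (suc _) = B

-- The points where the indicator function of A is not b.

off : Bool → Pred Cantor 0ℓ → Pred Cantor 0ℓ
off true  A = ∁ A
off false A = A

-- Enumeration of pairs of a bit and a string.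

-- Bijective binary numerals are bit strings: the three constructors of `ℕᵇ` correspond to nil and
-- the two ways to cons.
bits : ℕᵇ → List Bool
bits ℕᵇ.zero  = []
bits 2[1+ n ] = true ∷ bits n
bits 1+[2 n ] = false ∷ bits n

bits-surjective : ∀ s → ∃[ n ] bits n ≡ s
bits-surjective []      = ℕᵇ.zero , refl
bits-surjective (b ∷ s) with b | bits-surjective s
... | true  | n , eq = 2[1+ n ] , cong (true ∷_) eq
... | false | n , eq = 1+[2 n ] , cong (false ∷_) eq

-- A pair is coded by a nonempty string; the default at `[]` merely lists one pair twice.
uncons : List Bool → Bool × List Bool
uncons []      = true , []
uncons (b ∷ s) = b , s

enum : ℕ → Bool × List Bool
enum n = uncons (bits (ℕᵇ.fromℕ n))

enum-surjective : ∀ p → ∃[ n ] enum n ≡ p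
enum-surjective (b , s) with bits-surjective (b ∷ s)
... | n , eq = ℕᵇ.toℕ n , trans (cong (uncons ∘ bits) (fromℕ-toℕ n)) (cong uncons eq)

-- Classical reasoning and the outer measure of cylinders.

module _ (em : ExcludedMiddle (lsuc 0ℓ)) where

  em₀ : ExcludedMiddle 0ℓ
  em₀ {P} = map′ lower lift (em {Lift (lsuc 0ℓ) P})

  dne₀ : ∀ {P : Set} → ¬ ¬ P → P
  dne₀ = decidable-stable em₀

  off-△ : ∀ b {A B} → off b A ⊆ off b B ∪ (A △ B)
  off-△ true  {A} {B} {x} ¬a with em₀ {B x}
  ... | yes b = inj₂ (inj₂ (b , ¬a))
  ... | no ¬b = inj₁ ¬b
  off-△ false {A} {B} {x} a with em₀ {B x}
  ... | yes b = inj₁ b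
  ... | no ¬b = inj₂ (inj₁ (a , ¬b))

  -- A sequence of cylinders of total share at most ½ in ⟦ u ⟧ has total share
  -- at most ½ in one of the halves of ⟦ u ⟧, hence along a whole branch, whose
  -- limit is therefore not covered.
  cylinder-lower-bound : ∀ b t → weight (b ∷ t) ∉ μ ⟦ t ⟧
  cylinder-lower-bound b t (c , covers , r , r<w , ∑≤r) = uncovered
    where
    total : List Bool → ℕ → ℚ
    total u = ∑ (λ i → share (c i) u)

    total-mono : ∀ u {m n} → m ℕ.≤ n → total u m ≤ total u n
    total-mono u = ∑-monoʳ-≤ (λ i → share-nonNeg (c i) u)

    total-split : ∀ u n →
      total (u ∷ʳ false) n + total (u ∷ʳ true) n ≡ total u n + total u n
    total-split u n = begin
      total (u ∷ʳ false) n + total (u ∷ʳ true) n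
        ≡⟨ ∑-distrib-+ (λ i → share (c i) (u ∷ʳ false)) (λ i → share (c i) (u ∷ʳ true)) n ⟨
      ∑ (λ i → share (c i) (u ∷ʳ false) + share (c i) (u ∷ʳ true)) n
        ≡⟨ ∑-cong (λ i → share-split (c i) u) n ⟩
      ∑ (λ i → share (c i) u + share (c i) u) n
        ≡⟨ ∑-distrib-+ (λ i → share (c i) u) (λ i → share (c i) u) n ⟩
      total u n + total u n ∎
      where open ≡-Reasoning

    Thin : Pred (List Bool) 0ℓ
    Thin u = ∀ n → total u n ≤ ½

    thin-t : Thin t
    -- Multiplied by `weight t`, the shares become the measures of the parts of the cover inside
    -- `⟦ t ⟧`, whose sum is at most `r`, hence below half of `weight t`.
    thin-t n = *-cancelˡ-≤-pos (weight t) {{positive (weight-pos t)}} (begin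
      weight t * total t n                ≡⟨ *-distribˡ-∑ (weight t) (λ i → share (c i) t) n ⟩
      ∑ (λ i → weight t * share (c i) t) n ≤⟨ ∑-monoˡ-≤ (λ i → weight*share≤weight (c i) t) n ⟩
      ∑weights c n                        ≤⟨ ∑≤r n ⟩
      r                                   ≤⟨ <⇒≤ r<w ⟩
      ½ * weight t                        ≡⟨ *-comm ½ (weight t) ⟩
      weight t * ½                        ∎)
      where open ≤-Reasoning

    thin-half : ∀ u → Thin u → ∃[ b ] Thin (u ∷ʳ b)
    thin-half u thin with em₀ {Thin (u ∷ʳ false)}
    ... | yes thin-false = false , thin-false
    ... | no ¬thin-false = true , λ n → ≮⇒≥ λ ½<true →
      ¬thin-false λ m → ≮⇒≥ λ ½<false →
        -- The two halves may exceed ½ at different indices. Partial sums increase, so both exceed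
        -- it at the maximum `k`, and the sum over the halves passes the bound 1 given by
        -- `total-split`.
        let k = m ℕ.⊔ n in
        <-irrefl refl (<-≤-trans
            (+-mono-< (<-≤-trans ½<false (total-mono (u ∷ʳ false) (ℕ.m≤m⊔n m n)))
                      (<-≤-trans ½<true  (total-mono (u ∷ʳ true)  (ℕ.m≤n⊔m m n))))
            (≤-trans (≤-reflexive (total-split u k)) (+-mono-≤ (thin k) (thin k))))

    R : ℕ → Pred (List Bool) 0ℓ
    R _ u = Thin u × ⟦ u ⟧ ⊆ ⟦ t ⟧

    extend : ∀ n u → R n u →
             ∃[ v ] length u ℕ.< length v × ⟦ v ⟧ ⊆ ⟦ u ⟧ × R (suc n) v
    extend n u (thin , u⊆t) with thin-half u thin
    ... | b , thin-b = u ∷ʳ b , length-∷ʳ u b ,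
      (λ {x} → cylinder-++ u (b ∷ []) {x}) , thin-b ,
      λ {x} → u⊆t {x} ∘ cylinder-++ u (b ∷ []) {x}

    avoids-cover : ∀ x → x ∈ ⟦ t ⟧ →
      (∀ n → ∃[ u ] x ∈ ⟦ u ⟧ × n ℕ.≤ length u × R n u) → ∀ i → x ∉ ⟦ c i ⟧
    avoids-cover x x∈t along i x∈cᵢ =
      -- A string on the branch at least as long as `c i` has its cylinder inside `⟦ c i ⟧`, so this
      -- one term already contributes share 1.
      let u , x∈u , cᵢ≤u , thin , _ = along (length (c i)) in
      <-irrefl refl (begin-strict
        ½                    <⟨ toWitness {a? = ½ <? 1ℚ} _ ⟩
        1ℚ                   ≡⟨ share-full (c i) u {x} x∈cᵢ x∈u cᵢ≤u ⟨
        share (c i) u        ≤⟨ term≤∑ (λ j → share-nonNeg (c j) u) i ⟩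
        total u (suc i)      ≤⟨ thin (suc i) ⟩
        ½                    ∎)
      where open ≤-Reasoning

    uncovered : ⊥
    uncovered =
      let x , along = branch R extend {t} (thin-t , id)
          _ , x∈v , _ , _ , v⊆t = along 0
          x∈t = v⊆t {x} x∈v
          i , x∈cᵢ = covers {x} x∈t
      in avoids-cover x x∈t along i x∈cᵢ

  -- Baire category in the Cantor space.

  -- Otherwise `D` and its complement are both dense. Then the open sets `∁ (F n)`, which contain
  -- `∁ D`, and `U n`, which contain `D`, are dense, and so are the `V n`. A branch through all
  -- `V n` ends in a point of `⋂ ℕ U` outside `⋃ ℕ F`, that is, both in and outside `D`.
  Δ⁰₂-constant-on-cylinder : ∀ {D} → Δ⁰₂ D → ∃[ b ] ∃[ s ] Empty (⟦ s ⟧ ∩ off b D)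
  Δ⁰₂-constant-on-cylinder {D}
    ((F , F-closed , D⊆⋃F , ⋃F⊆D) , (U , U-open , D⊆⋂U , ⋂U⊆D)) =
    dne₀ λ none → contra (λ b s → dne₀ λ ¬x → none (b , s , λ x h → ¬x (x , h)))
    where
    V : ℕ → Pred Cantor 0ℓ
    V n = ∁ (F n) ∩ U n

    R : ℕ → Pred (List Bool) 0ℓ
    -- Stage `suc n` enters `V n`; stage 0 is the unconstrained root.
    R zero    _ = ⊤
    R (suc n) t = ⟦ t ⟧ ⊆ V n

    extend : (∀ b s → ∃[ x ] x ∈ ⟦ s ⟧ ∩ off b D) → ∀ n s → R n s →
             ∃[ t ] length s ℕ.< length t × ⟦ t ⟧ ⊆ ⟦ s ⟧ × R (suc n) t
    extend dense n s _ =
      let y , y∈s , y∉D = dense true s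
          t , s<t , t⊆s , t∩F =
            open-refine (F-closed n) s {y} y∈s (λ y∈F → y∉D (⋃F⊆D (n , y∈F)))
          z , z∈t , z∈D = dense false t
          u , t<u , u⊆t , u⊆U = open-refine (U-open n) t {z} z∈t (D⊆⋂U z∈D n)
      in u , ℕ.<-trans s<t t<u ,
         (λ {x} → t⊆s {x} ∘ u⊆t {x}) ,
         λ {x} x∈u → t∩F {x} (u⊆t {x} x∈u) , u⊆U {x} x∈u

    ⋂V-empty : ∀ x → ¬ (∀ n → x ∈ V n)
    ⋂V-empty x x∈V =
      let n , x∈F = D⊆⋃F (⋂U⊆D {x} (proj₂ ∘ x∈V)) in proj₁ (x∈V n) x∈F

    contra : ¬ (∀ b s → ∃[ x ] x ∈ ⟦ s ⟧ ∩ off b D)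
    contra dense =
      let x , along = branch R (extend dense) {[]} tt
      in ⋂V-empty x λ n →
        let t , x∈t , _ , t⊆V = along (suc n) in t⊆V {x} x∈t

  -- Nowhere dense sets in the measure algebra.

  open MetricSpace (MALG em) using (Carrier; d; _≈_; NowhereDense)

  AEConstant : Bool → List Bool → Pred Carrier 0ℓ
  AEConstant b s A = Null (⟦ s ⟧ ∩ off b (set A))

  Δ⁰₂-ae : Pred Carrier (lsuc 0ℓ)
  Δ⁰₂-ae A = Σ[ D ∈ Pred Cantor 0ℓ ] Δ⁰₂ D × Null (set A △ D)

  AEConstant-resp-≈ : ∀ b s → AEConstant b s Respects _≈_
  AEConstant-resp-≈ b s {A} {B} A≈B null =
    Null-⊆ {⟦ s ⟧ ∩ off b (set B)} {(⟦ s ⟧ ∩ off b (set A)) ∪ (set A △ set B)}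
      (λ { {x} (x∈s , x∈B) → map₁ (x∈s ,_)
             (map₂ (△-sym {set B} {set A}) (off-△ b {set B} {set A} x∈B)) })
      (Null-∪ {⟦ s ⟧ ∩ off b (set A)} {set A △ set B} null A≈B)

  Δ⁰₂-ae-resp-≈ : Δ⁰₂-ae Respects _≈_
  Δ⁰₂-ae-resp-≈ {A} {B} A≈B (D , Δ , null) = D , Δ ,
    Null-⊆ {set B △ D} {(set A △ set B) ∪ (set A △ D)}
      (λ p → map₁ (△-sym {set B} {set A}) (△-triangle em {set B} {set A} {D} p))
      (Null-∪ {set A △ set B} {set A △ D} A≈B null)

  -- Where `D` has constant value `b`, every point at which `A` has the other value lies in the null
  -- set `set A △ D`.
  Δ⁰₂-ae⇒AEConstant : ∀ {A} → Δ⁰₂-ae A → ∃[ b ] ∃[ s ] AEConstant b s A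
  Δ⁰₂-ae⇒AEConstant {A} (D , Δ , null) =
    let b , s , constant = Δ⁰₂-constant-on-cylinder Δ
    in b , s , Null-⊆ {⟦ s ⟧ ∩ off b (set A)} {set A △ D}
      (λ {x} (x∈s , x∈A) →
         [ (λ x∈D → contradiction (x∈s , x∈D) (constant x)) , id ]′
         (off-△ b {set A} {D} x∈A))
      null

  Measurable-∖ : ∀ {A B} → Measurable A → Measurable B → Measurable (A ∖ B)
  Measurable-∖ mA mB = same
    ((λ h → dne₀ (h ∘ inj₁) , h ∘ inj₂) ,
     (λ { (a , ¬b) → [ (λ ¬a → ¬a a) , ¬b ]′ }))
    (complement (Measurable-∪ (complement mA) mB))

  -- Gives `A` the value opposite to `b` on all of `⟦ t ⟧`, violating `AEConstant b` there as
  -- strongly as possible.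
  switch : Bool → List Bool → Carrier → Carrier
  switch true t A = record
    { set        = set A ∖ ⟦ t ⟧
    ; measurable = Measurable-∖ (measurable A) (cylinder-measurable t) }
  switch false t A = record
    { set        = set A ∪ ⟦ t ⟧
    ; measurable = Measurable-∪ (measurable A) (cylinder-measurable t) }

  switch-off : ∀ b t A → ⟦ t ⟧ ⊆ off b (set (switch b t A))
  switch-off true  t A x∈t (_ , x∉t) = x∉t x∈t
  switch-off false t A x∈t           = inj₂ x∈t

  switch-△ : ∀ b t A → set A △ set (switch b t A) ⊆ ⟦ t ⟧
  switch-△ true  t A (inj₁ (a , ¬b))       = dne₀ (λ x∉t → ¬b (a , x∉t))
  switch-△ true  t A (inj₂ ((a , _) , ¬a)) = contradiction a ¬a
  switch-△ false t A (inj₁ (a , ¬b))       = contradiction (inj₁ a) ¬b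
  switch-△ false t A (inj₂ (inj₁ a , ¬a))  = contradiction a ¬a
  switch-△ false t A (inj₂ (inj₂ x∈t , _)) = x∈t

  -- Stated for subsets `P` because the final decomposition uses intersections with `Δ⁰₂-ae`, which
  -- also live in the universe that `NowhereDense` expects.
  AEConstant-nowhereDense : ∀ b s {P : Pred Carrier (lsuc 0ℓ)} →
    P ⊆ AEConstant b s → NowhereDense P
  AEConstant-nowhereDense b s {P} P⊆ A (ε , 0<ε , ball⊆closure) =
    let k , ½^k<ε = ½^-small 0<ε
    -- `B k` lies in the ball, hence in the closure of `P`; the closure is tested at a quarter of
    -- the weight of `t k`.
    in far k (ball⊆closure {B k} (near k ½^k<ε) (weight-pos (true ∷ true ∷ t k)))
    where
    t : ℕ → List Bool
    -- The `suc k` extra bits give weight at most `½^ suc k`, as `μ-cylinder-≤` demands.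
    t k = s ++ replicate (suc k) true

    B : ℕ → Carrier
    B k = switch b (t k) A

    near : ∀ k → ½^ k < ε → ε ∈ d A (B k)
    near k ½^k<ε = μ-mono {set A △ set (B k)} {⟦ t k ⟧}
      (λ {x} → switch-△ b (t k) A {x})
      (μ-cylinder-≤ {t k} {k} (weight-++-≤ s (replicate (suc k) true)) ½^k<ε)

    far : ∀ k → ¬ (∃[ C ] weight (true ∷ true ∷ t k) ∈ d (B k) C × C ∈ P)
    -- On `⟦ t k ⟧` the set `B k` is nowhere `b`, so each point there is in the null exceptional set
    -- of `C` or in `set (B k) △ set C`. Allowing a quarter of the weight for each covers `⟦ t k ⟧`
    -- within half its weight, against `cylinder-lower-bound`.
    far k (C , B-near-C , C∈P) = cylinder-lower-bound true (t k)
      (subst (_∈ μ ⟦ t k ⟧) (halves (weight (true ∷ t k)))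
        (μ-mono {⟦ t k ⟧} {(⟦ s ⟧ ∩ off b (set C)) ∪ (set (B k) △ set C)}
          (λ {x} x∈t → map₁ (cylinder-++ s (replicate (suc k) true) {x} x∈t ,_)
            (off-△ b {set (B k)} {set C} (switch-off b (t k) A {x} x∈t)))
          (μ-subadditive {⟦ s ⟧ ∩ off b (set C)} {set (B k) △ set C}
            (P⊆ {C} C∈P (weight-pos (true ∷ true ∷ t k))) B-near-C)))

theorem1p6 : (em : ExcludedMiddle (lsuc 0ℓ)) →
    MetricSpace.Comeager (MALG em)
    (λ A → ¬ (Σ[ D ∈ Pred Cantor 0ℓ ] Δ⁰₂ D × Null (set A △ D)))
theorem1p6 em =
  -- `Meager` asks for equality with the union, not inclusion, and an almost everywhere constant
  -- class on a cylinder need not be `Δ⁰₂-ae`; hence the intersection.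
  (λ n A → Δ⁰₂-ae em A × uncurry (AEConstant em) (enum n) A) ,
  (λ n → let b , s = enum n in
    (λ {A} {B} A≈B (Δ , c) → Δ⁰₂-ae-resp-≈ em {A} {B} A≈B Δ ,
                             AEConstant-resp-≈ em b s {A} {B} A≈B c) ,
    AEConstant-nowhereDense em b s proj₂) ,
  (λ {A} ¬¬Δ → cover {A} (decidable-stable em ¬¬Δ)) ,
  (λ (_ , Δ , _) ¬Δ → ¬Δ Δ)
  where
  cover : ∀ {A} → Δ⁰₂-ae em A →
    ∃[ n ] Δ⁰₂-ae em A × uncurry (AEConstant em) (enum n) A
  cover {A} Δ =
    let b , s , c = Δ⁰₂-ae⇒AEConstant em {A} Δ
        n , eq = enum-surjective (b , s)
    in n , Δ , subst (λ p → uncurry (AEConstant em) p A) (sym eq) c
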